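{- Let $n \geq 8$ be an even integer. Then $s(n, \mathcal{PM}) \geq \binom{n-4}{2}$, both when Mini moves first and when Max moves first.
   Context: Let $\mathcal{P}$ be a monotone increasing property of graphs on vertex set $[n]$. An edge $e \in \binom{[n]}{2}\setminus E(G)$ is legal with respect to a graph $G \notin \mathcal{P}$ if $G \cup \{e\} \notin \mathcal{P}$. The saturation game $(n,\mathcal{P})$: starting from the empty graph on $[n]$, two players, Mini and Max, alternately add a legal edge to the current graph $G$. The game ends when no legal edge exists. Max wants to maximize the number of edges of the final graph and Mini wants to minimize it. The score $s(n,\mathcal{P})$ is the number of edges of the final graph under optimal play by both players; it may depend on which player moves first. $\mathcal{PM}$ denotes the property of admitting a perfect matching. -}

module Defs where

open import Data.Nat using (ℕ)
open import Data.Fin using (Fin; _<_)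
open import Data.Product using (Σ; _×_; _,_; ∃)
open import Data.List using (List; []; _∷_; length)
open import Data.List.Membership.Propositional using (_∈_)
open import Relation.Nullary using (¬_)
open import Relation.Binary.PropositionalEquality using (_≡_; _≢_)
open import Data.Sum using (_⊎_)

-- A (potential) edge on vertex set Fin n is an ordered pair (i , j);
-- an edge {i,j} is represented canonically by the pair with i < j.
Pair : ℕ → Set
Pair n = Fin n × Fin n

-- A graph on vertex set Fin n, given by the list of its edges
-- (each stored as (i , j) with i < j, without repetitions).
-- During the game, edges are only ever added via legal moves, which
-- guarantees these invariants.
Graph : ℕ → Set
Graph n = List (Pair n)

edgeCount : ∀ {n} → Graph n → ℕ
edgeCount G = length G

Adj : ∀ {n} → Graph n → Fin n → Fin n → Set
Adj G u v = ((u , v) ∈ G) ⊎ ((v , u) ∈ G)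

HasPM : ∀ {n} → Graph n → Set
HasPM {n} G = Σ (Fin n → Fin n) λ μ →
  ((v : Fin n) → μ (μ v) ≡ v) ×
  ((v : Fin n) → μ v ≢ v) ×
  ((v : Fin n) → Adj G v (μ v))

Legal : ∀ {n} → Graph n → Pair n → Set
Legal G (i , j) = (i < j) × ¬ ((i , j) ∈ G) × ¬ HasPM ((i , j) ∷ G)

data Player : Set where
  Mini Max : Player

data MaxForces {n : ℕ} (k : ℕ) : Graph n → Player → Set where
  finished : ∀ {G p} →
    ((e : Pair n) → ¬ Legal G e) →
    k Data.Nat.≤ edgeCount G →
    MaxForces k G p
  maxMove : ∀ {G} (e : Pair n) →
    Legal G e →
    MaxForces k (e ∷ G) Mini →
    MaxForces k G Max
  miniMove : ∀ {G} →
    (∃ λ e → Legal G e) →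
    ((e : Pair n) → Legal G e → MaxForces k (e ∷ G) Max) →
    MaxForces k G Mini

ScoreAtLeast : ℕ → Player → ℕ → Set
ScoreAtLeast n p k = MaxForces {n} k [] p

{-# OPTIONS --safe #-}
module Submission where

-- Max keeps all non-isolated vertices on one path: a chord of Mini is answered by lengthening the path, and an
-- edge of Mini that uses isolated vertices can be absorbed into the path with one further edge.  Each round the
-- number of isolated vertices drops by one or two, so at some point Mini is to move with three or four of them left.
-- From then on Max closes the path to a cycle and extends the cycle.  An odd cycle through all vertices but one, or
-- through all but three with an edge among these three, becomes a clique: it is perfectly matchable after deleting
-- any one vertex, so a chord could complete a perfect matching only if there already was one.  Around an even
-- cycle, Max answers chords by chords until there is a clique on at least n − 4 vertices, and any other move of Mini
-- lets Max enlarge the cycle to an odd one (or to an even one with fewer outside vertices), except that Mini may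
-- start a star outside the cycle, which Max completes: its leaves have only one common neighbour.

open import Defs
open import Data.Nat using (ℕ; zero; suc; _+_; _≤_; _∸_; z≤n; s≤s)
open import Data.Nat.Properties using (≤-refl; ≤-trans; ≤-reflexive; +-mono-≤; n≤1+n; ∸-monoˡ-≤; m+n∸m≡n; +-monoˡ-≤; suc-injective)
open import Data.Nat.Divisibility using (_∣_; ∣m+n∣m⇒∣n; ∣-refl; ∣⇒≤)
open import Data.Nat.Combinatorics using (_C_; nC1≡n; nCk+nC[k+1]≡[n+1]C[k+1])
open import Data.Fin as Fin using (Fin)
import Data.Fin.Properties as Fin
open import Data.Product using (_×_; _,_; proj₁; proj₂; ∃)
open import Data.Product.Properties using (≡-dec)
open import Data.Sum as Sum using (_⊎_; inj₁; inj₂; [_,_]′)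
open import Data.Empty using (⊥; ⊥-elim)
open import Data.List using (List; []; _∷_; _++_; _∷ʳ_; _ʳ++_; length; map; allFin; tabulate; cartesianProduct; initLast; _∷ʳ′_)
open import Data.List.Properties using (++-assoc; length-++; length-map; length-tabulate)
open import Data.List.Membership.Propositional using (_∈_; _∉_; find; lose)
open import Data.List.Membership.Propositional.Properties using (∈-++⁺ˡ; ∈-++⁺ʳ; ∈-++⁻; ∈-∃++; ∈-allFin; ∈-cartesianProduct⁺; ∈-cartesianProduct⁻; ∈-map⁻)
import Data.List.Membership.DecPropositional as DecMembership
open import Data.List.Relation.Unary.Any as Any using (here; there)
open import Data.List.Relation.Unary.All as All using (All; []; _∷_)
import Data.List.Relation.Unary.All.Properties as All
open import Data.List.Relation.Unary.AllPairs using ([]; _∷_)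
open import Data.List.Relation.Unary.Linked as Linked using (Linked; []; [-]; _∷_)
open import Data.List.Relation.Unary.Unique.Propositional using (Unique)
import Data.List.Relation.Unary.Unique.Propositional.Properties as Unique
open import Data.List.Relation.Binary.Permutation.Propositional using (_↭_; ↭-refl; ↭-sym; ↭-trans; prep; swap; ↭⇒↭ₛ)
open import Data.List.Relation.Binary.Permutation.Propositional.Properties using (∈-resp-↭; All-resp-↭; ↭-length; shift; ++⁺ˡ; ++⁺ʳ; ++-comm; ++↭ʳ++)
import Data.List.Relation.Binary.Permutation.Setoid.Properties as SetoidPermutation
import Data.Vec.Functional as Vector
open import Function using (_∘_; id; case_of_)
open import Relation.Nullary using (¬_; Dec; yes; no)
open import Relation.Nullary.Decidable using (map′; _×-dec_; _⊎-dec_; ¬?; decidable-stable)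
open import Relation.Binary.Definitions using (DecidableEquality; tri<; tri≈; tri>)
open import Relation.Binary.PropositionalEquality using (_≡_; _≢_; _≗_; refl; sym; trans; cong; subst; setoid; ≢-sym)

private
  variable
    n : ℕ
    A : Set
    x y : A
    xs ys : List A

-- Lists

pick : x ∈ xs → ∃ λ ys → xs ↭ x ∷ ys
pick x∈xs with ∈-∃++ x∈xs
... | as , bs , refl = as ++ bs , shift _ as bs

Unique-resp-↭ : xs ↭ ys → Unique xs → Unique ys
Unique-resp-↭ p = SetoidPermutation.Unique-resp-↭ (setoid _) (↭⇒↭ₛ p)

Unique-tail : Unique (x ∷ xs) → Unique xs
Unique-tail (_ ∷ u) = u

Unique-++ʳ : ∀ (xs : List A) → Unique (xs ++ ys) → Unique ys
Unique-++ʳ []       u = u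
Unique-++ʳ (_ ∷ xs) u = Unique-++ʳ xs (Unique-tail u)

∈∷⇒≢ : Unique (x ∷ xs) → y ∈ xs → x ≢ y
∈∷⇒≢ (x≢ ∷ _) y∈ = All.lookup x≢ y∈

length-⊆ : Unique xs → (∀ {z} → z ∈ xs → z ∈ ys) → length xs ≤ length ys
length-⊆ {xs = []} _ _ = z≤n
length-⊆ {xs = x ∷ xs} {ys = ys} u@(_ ∷ uxs) xs⊆ys with pick (xs⊆ys (here refl))
... | zs , p = ≤-trans (s≤s (length-⊆ uxs xs⊆zs)) (≤-reflexive (sym (↭-length p)))
  where
  xs⊆zs : ∀ {z} → z ∈ xs → z ∈ zs
  xs⊆zs z∈ with ∈-resp-↭ p (xs⊆ys (there z∈))
  ... | here z≡x = ⊥-elim (∈∷⇒≢ u z∈ (sym z≡x))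
  ... | there z∈zs = z∈zs

module _ {_~_ : A → A → Set} where

  Linked-++⁻ : ∀ xs → Linked _~_ (xs ++ y ∷ ys) → Linked _~_ (xs ++ y ∷ []) × Linked _~_ (y ∷ ys)
  Linked-++⁻ [] l = [-] , l
  Linked-++⁻ (x ∷ []) (r ∷ l) = r ∷ [-] , l
  Linked-++⁻ (x ∷ x′ ∷ xs) (r ∷ l) with Linked-++⁻ (x′ ∷ xs) l
  ... | l₁ , l₂ = r ∷ l₁ , l₂

  Linked-++⁺ : ∀ xs → Linked _~_ (xs ++ y ∷ []) → Linked _~_ (y ∷ ys) → Linked _~_ (xs ++ y ∷ ys)
  Linked-++⁺ [] _ l = l
  Linked-++⁺ (x ∷ []) (r ∷ _) l = r ∷ l
  Linked-++⁺ (x ∷ x′ ∷ xs) (r ∷ l₁) l₂ = r ∷ Linked-++⁺ (x′ ∷ xs) l₁ l₂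

  Linked-init : ∀ xs → Linked _~_ (xs ++ y ∷ []) → Linked _~_ xs
  Linked-init [] _ = []
  Linked-init (x ∷ []) _ = [-]
  Linked-init (x ∷ x′ ∷ xs) (r ∷ l) = r ∷ Linked-init (x′ ∷ xs) l

  Linked-ʳ++ : (∀ {x y} → x ~ y → y ~ x) → x ~ y → Linked _~_ (x ∷ xs) → Linked _~_ (y ∷ ys) →
               Linked _~_ ((x ∷ xs) ʳ++ (y ∷ ys))
  Linked-ʳ++ ~-sym r [-] l = r ∷ l
  Linked-ʳ++ ~-sym r (r′ ∷ l′) l = Linked-ʳ++ ~-sym (~-sym r′) l′ (r ∷ l)

-- The search runs over the values at each argument in turn. A function is recovered only up to
-- pointwise equality, hence the assumption that `P` respects `≗`.
∃-function? : ∀ m {k} {P : (Fin m → Fin k) → Set} → (∀ {f g} → f ≗ g → P f → P g) →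
              (∀ f → Dec (P f)) → Dec (∃ P)
∃-function? zero resp P? = map′ (_ ,_) (λ (f , p) → resp (λ ()) p) (P? λ ())
∃-function? (suc m) {P = P} resp P? =
  map′ (λ (x , f , p) → x Vector.∷ f , p)
       (λ (f , p) → f Fin.zero , f ∘ Fin.suc , resp (λ { Fin.zero → refl ; (Fin.suc i) → refl }) p)
       (Fin.any? λ x → ∃-function? m {P = λ f → P (x Vector.∷ f)}
         (λ f≗g → resp λ { Fin.zero → refl ; (Fin.suc i) → f≗g i }) λ f → P? (x Vector.∷ f))

-- Adjacency

_≟ₑ_ : DecidableEquality (Pair n)
_≟ₑ_ = ≡-dec Fin._≟_ Fin._≟_

_∈?_ : (e : Pair n) (G : Graph n) → Dec (e ∈ G)
_∈?_ = DecMembership._∈?_ _≟ₑ_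

Adj? : (G : Graph n) → ∀ u v → Dec (Adj G u v)
Adj? G u v = ((u , v) ∈? G) ⊎-dec ((v , u) ∈? G)

-- Pairs are stored with the smaller end first, whereas the strategy does not know which end is
-- smaller; `Joins` hides the order.
Joins : Pair n → Fin n → Fin n → Set
Joins e u v = e ≡ (u , v) ⊎ e ≡ (v , u)

private
  variable
    G G′ : Graph n
    e : Pair n
    u v w r s a b c d h : Fin n
    L R H : List (Fin n)

Adj-sym : Adj G u v → Adj G v u
Adj-sym = Sum.swap

Adj-mono : (∀ {e} → e ∈ G → e ∈ G′) → Adj G u v → Adj G′ u v
Adj-mono G⊆G′ = Sum.map G⊆G′ G⊆G′

Adj-there : Adj G u v → Adj (e ∷ G) u v
Adj-there = Adj-mono there

Adj-here : Joins e u v → Adj (e ∷ G) u v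
Adj-here = Sum.map (here ∘ sym) (here ∘ sym)

Adj-∷⁻ : Joins e u v → Adj (e ∷ G) a b → (a ≡ u × b ≡ v ⊎ a ≡ v × b ≡ u) ⊎ Adj G a b
Adj-∷⁻ _ (inj₁ (there p)) = inj₂ (inj₁ p)
Adj-∷⁻ _ (inj₂ (there p)) = inj₂ (inj₂ p)
Adj-∷⁻ (inj₁ refl) (inj₁ (here refl)) = inj₁ (inj₁ (refl , refl))
Adj-∷⁻ (inj₁ refl) (inj₂ (here refl)) = inj₁ (inj₂ (refl , refl))
Adj-∷⁻ (inj₂ refl) (inj₁ (here refl)) = inj₁ (inj₂ (refl , refl))
Adj-∷⁻ (inj₂ refl) (inj₂ (here refl)) = inj₁ (inj₁ (refl , refl))

Adj-∷⁻-avoid : Joins e u v → a ≢ u → a ≢ v → Adj (e ∷ G) a b → Adj G a b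
Adj-∷⁻-avoid j a≢u a≢v adj with Adj-∷⁻ j adj
... | inj₁ (inj₁ (a≡u , _)) = ⊥-elim (a≢u a≡u)
... | inj₁ (inj₂ (a≡v , _)) = ⊥-elim (a≢v a≡v)
... | inj₂ adj′ = adj′

Isolated : Graph n → Fin n → Set
Isolated G v = ∀ u → ¬ Adj G v u

-- The vertex `w` itself may fail to be a neighbour, so an isolated vertex qualifies for every `w`.
-- This lets a future leaf be treated before its edge is drawn.
NbrsIn : Graph n → Fin n → Fin n → Set
NbrsIn G v w = ∀ u → Adj G v u → u ≡ w

Isolated-∷ : Joins e u v → a ≢ u → a ≢ v → Isolated G a → Isolated (e ∷ G) a
Isolated-∷ j a≢u a≢v iso b adj = iso b (Adj-∷⁻-avoid j a≢u a≢v adj)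

NbrsIn-∷ : Joins e u v → a ≢ u → a ≢ v → NbrsIn G a w → NbrsIn (e ∷ G) a w
NbrsIn-∷ j a≢u a≢v only b adj = only b (Adj-∷⁻-avoid j a≢u a≢v adj)

NbrsIn-new : Joins e u w → a ≢ w → NbrsIn G a w → NbrsIn (e ∷ G) a w
NbrsIn-new j a≢w only b adj with Adj-∷⁻ j adj
... | inj₁ (inj₁ (_ , b≡w)) = b≡w
... | inj₁ (inj₂ (a≡w , _)) = ⊥-elim (a≢w a≡w)
... | inj₂ adj′ = only b adj′

Isolated⇒NbrsIn : Isolated G a → NbrsIn G a w
Isolated⇒NbrsIn iso b adj = ⊥-elim (iso b adj)

-- Perfect matchings

isolated⇒noPM : Isolated G v → ¬ HasPM G
isolated⇒noPM iso (μ , _ , _ , adj) = iso _ (adj _)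

someIsolated⇒noPM : ∀ {k} → length R ≡ suc k → All (Isolated G) R → ¬ HasPM G
someIsolated⇒noPM _ (iso ∷ _) = isolated⇒noPM iso

-- A perfect matching would pair both `b` and `c` with `a`.
twoLeaves⇒noPM : NbrsIn G b a → NbrsIn G c a → b ≢ c → ¬ HasPM G
twoLeaves⇒noPM onlyb onlyc b≢c (μ , inv , _ , adj) =
  b≢c (trans (sym (inv _)) (trans (cong μ (trans (onlyb _ (adj _)) (sym (onlyc _ (adj _))))) (inv _)))

HasPM? : (G : Graph n) → Dec (HasPM G)
HasPM? {n} G = ∃-function? n resp λ μ →
  Fin.all? (λ v → μ (μ v) Fin.≟ v) ×-dec
  (Fin.all? (λ v → ¬? (μ v Fin.≟ v)) ×-dec Fin.all? (λ v → Adj? G v (μ v)))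
  where
  resp : {f g : Fin n → Fin n} → f ≗ g → _ → _
  resp {f} {g} f≗g (inv , irr , adj) =
    (λ v → trans (sym (trans (f≗g (f v)) (cong g (f≗g v)))) (inv v)) ,
    (λ v p → irr v (trans (f≗g v) p)) ,
    λ v → subst (Adj G v) (f≗g v) (adj v)

-- A matching written as a list whose consecutive entries are paired off. Matchings built from paths
-- and single edges have this form, and `Matched⇒HasPM` turns them into involutions.
data Matched (G : Graph n) : List (Fin n) → Set where
  []   : Matched G []
  pair : Adj G u v → Matched G xs → Matched G (u ∷ v ∷ xs)

module _ {G : Graph n} where

  partner : Matched G xs → Fin n → Fin n
  -- A default value: vertices outside the list are fixed.
  partner [] w = w
  partner (pair {u} {v} _ m) w with w Fin.≟ u | w Fin.≟ v
  ... | yes _ | _     = v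
  ... | no _  | yes _ = u
  ... | no _  | no _  = partner m w

  partner-∈ : (m : Matched G xs) → w ∈ xs → partner m w ∈ xs
  partner-∈ {w = w} (pair {u} {v} _ m) w∈ with w Fin.≟ u | w Fin.≟ v
  ... | yes _ | _     = there (here refl)
  ... | no _  | yes _ = here refl
  partner-∈ (pair _ m) (here p)         | no w≢u | no _   = ⊥-elim (w≢u p)
  partner-∈ (pair _ m) (there (here p)) | no _   | no w≢v = ⊥-elim (w≢v p)
  partner-∈ (pair _ m) (there (there p)) | no _ | no _ = there (there (partner-∈ m p))

  partner-adj : (m : Matched G xs) → w ∈ xs → Adj G w (partner m w)
  partner-adj {w = w} (pair {u} {v} uv m) w∈ with w Fin.≟ u | w Fin.≟ v
  ... | yes refl | _        = uv
  ... | no _     | yes refl = Adj-sym uv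
  partner-adj (pair _ m) (here p)         | no w≢u | no _   = ⊥-elim (w≢u p)
  partner-adj (pair _ m) (there (here p)) | no _   | no w≢v = ⊥-elim (w≢v p)
  partner-adj (pair _ m) (there (there p)) | no _ | no _ = partner-adj m p

  partner-≢ : (m : Matched G xs) → Unique xs → w ∈ xs → partner m w ≢ w
  partner-≢ {w = w} (pair {u} {v} _ m) uq w∈ with w Fin.≟ u | w Fin.≟ v
  ... | yes refl | _        = ∈∷⇒≢ uq (here refl) ∘ sym
  ... | no _     | yes refl = ∈∷⇒≢ uq (here refl)
  partner-≢ (pair _ m) _ (here p)         | no w≢u | no _   = ⊥-elim (w≢u p)
  partner-≢ (pair _ m) _ (there (here p)) | no _   | no w≢v = ⊥-elim (w≢v p)
  partner-≢ (pair _ m) (_ ∷ _ ∷ uq) (there (there p)) | no _ | no _ = partner-≢ m uq p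

  partner-first : (p : Adj G u v) (m : Matched G xs) → partner (pair p m) u ≡ v
  partner-first {u} p m with u Fin.≟ u
  ... | yes _ = refl
  ... | no u≢u = ⊥-elim (u≢u refl)

  partner-second : (p : Adj G u v) (m : Matched G xs) → u ≢ v → partner (pair p m) v ≡ u
  partner-second {u} {v} p m u≢v with v Fin.≟ u | v Fin.≟ v
  ... | yes v≡u | _ = ⊥-elim (u≢v (sym v≡u))
  ... | no _ | yes _ = refl
  ... | no _ | no v≢v = ⊥-elim (v≢v refl)

  partner-rest : (p : Adj G u v) (m : Matched G xs) → w ≢ u → w ≢ v → partner (pair p m) w ≡ partner m w
  partner-rest {u} {v} {w = w} p m w≢u w≢v with w Fin.≟ u | w Fin.≟ v
  ... | yes w≡u | _ = ⊥-elim (w≢u w≡u)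
  ... | no _ | yes w≡v = ⊥-elim (w≢v w≡v)
  ... | no _ | no _ = refl

  partner-involutive : (m : Matched G xs) → Unique xs → w ∈ xs → partner m (partner m w) ≡ w
  partner-involutive {w = w} (pair {u} {v} p m) uq w∈ with w Fin.≟ u | w Fin.≟ v
  ... | yes refl | _ = partner-second p m (∈∷⇒≢ uq (here refl))
  ... | no _ | yes refl = partner-first p m
  partner-involutive (pair _ m) _ (here p)         | no w≢u | no _   = ⊥-elim (w≢u p)
  partner-involutive (pair _ m) _ (there (here p)) | no _   | no w≢v = ⊥-elim (w≢v p)
  partner-involutive (pair p m) uq@(_ ∷ uq′@(_ ∷ uq″)) (there (there w∈)) | no _ | no _ =
    trans (partner-rest p m (≢-sym (∈∷⇒≢ uq (there (partner-∈ m w∈)))) (≢-sym (∈∷⇒≢ uq′ (partner-∈ m w∈))))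
          (partner-involutive m uq″ w∈)

∈-all : xs ↭ allFin n → (v : Fin n) → v ∈ xs
∈-all p v = ∈-resp-↭ (↭-sym p) (∈-allFin v)

allUnique : xs ↭ allFin n → Unique xs
allUnique {n = n} p = Unique-resp-↭ (↭-sym p) (Unique.allFin⁺ n)

Matched⇒HasPM : Matched G xs → xs ↭ allFin n → HasPM G
Matched⇒HasPM m p = partner m ,
  (λ v → partner-involutive m (allUnique p) (∈-all p v)) ,
  (λ v → partner-≢ m (allUnique p) (∈-all p v)) ,
  (λ v → partner-adj m (∈-all p v))

-- Every second edge of the path is taken, beginning with the first.
evenPath⇒Matched : Linked (Adj G) xs → 2 ∣ length xs → Matched G xs
evenPath⇒Matched [] _ = []
evenPath⇒Matched [-] 2∣1 = case ∣⇒≤ 2∣1 of λ { (s≤s ()) }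
evenPath⇒Matched (p ∷ l) even = pair p (evenPath⇒Matched (Linked.tail l) (∣m+n∣m⇒∣n even ∣-refl))

-- Cliques

edge : Fin n → Fin n → Pair n
edge u v with Fin.<-cmp u v
... | tri< _ _ _ = u , v
-- A default value; `edge-ordered` speaks of distinct ends only.
... | tri≈ _ _ _ = u , v
... | tri> _ _ _ = v , u

edge-joins : (u v : Fin n) → Joins (edge u v) u v
edge-joins u v with Fin.<-cmp u v
... | tri< _ _ _ = inj₁ refl
... | tri≈ _ _ _ = inj₁ refl
... | tri> _ _ _ = inj₂ refl

edge-ordered : u ≢ v → proj₁ (edge u v) Fin.< proj₂ (edge u v)
edge-ordered {u = u} {v} u≢v with Fin.<-cmp u v
... | tri< u<v _ _ = u<v
... | tri≈ _ u≡v _ = ⊥-elim (u≢v u≡v)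
... | tri> _ _ v<u = v<u

Joins-injective : Joins e u v → Joins e u w → v ≡ w
Joins-injective (inj₁ refl) (inj₁ refl) = refl
Joins-injective (inj₁ refl) (inj₂ refl) = refl
Joins-injective (inj₂ refl) (inj₁ refl) = refl
Joins-injective (inj₂ refl) (inj₂ refl) = refl

Joins-end : Joins e u v → Joins e a b → u ≡ a ⊎ u ≡ b
Joins-end (inj₁ refl) (inj₁ refl) = inj₁ refl
Joins-end (inj₁ refl) (inj₂ refl) = inj₂ refl
Joins-end (inj₂ refl) (inj₁ refl) = inj₂ refl
Joins-end (inj₂ refl) (inj₂ refl) = inj₁ refl

pairs : List (Fin n) → List (Pair n)
pairs [] = []
pairs (x ∷ xs) = map (edge x) xs ++ pairs xs

∈-pairs⁻ : ∀ xs → e ∈ pairs xs → ∃ λ u → ∃ λ v → e ≡ edge u v × u ∈ xs × v ∈ xs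
∈-pairs⁻ (x ∷ xs) e∈ with ∈-++⁻ (map (edge x) xs) e∈
... | inj₁ e∈₁ = let (y , y∈ , eq) = ∈-map⁻ (edge x) e∈₁ in x , y , eq , here refl , there y∈
... | inj₂ e∈₂ = let (u , v , eq , u∈ , v∈) = ∈-pairs⁻ xs e∈₂ in u , v , eq , there u∈ , there v∈

pairs-ordered : ∀ {xs : List (Fin n)} → Unique xs → e ∈ pairs xs → proj₁ e Fin.< proj₂ e × proj₁ e ∈ xs × proj₂ e ∈ xs
pairs-ordered {xs = x ∷ xs} uq e∈ with ∈-++⁻ (map (edge x) xs) e∈
... | inj₂ e∈₂ = let (lt , p , q) = pairs-ordered (Unique-tail uq) e∈₂ in lt , there p , there q
... | inj₁ e∈₁ with ∈-map⁻ (edge x) e∈₁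
...   | y , y∈ , refl = edge-ordered (∈∷⇒≢ uq y∈) , ends (edge-joins x y)
  where
  ends : Joins e x y → proj₁ e ∈ x ∷ xs × proj₂ e ∈ x ∷ xs
  ends (inj₁ refl) = here refl , there y∈
  ends (inj₂ refl) = there y∈ , here refl

pairs-unique : {xs : List (Fin n)} → Unique xs → Unique (pairs xs)
pairs-unique [] = []
pairs-unique {xs = x ∷ xs} uq@(_ ∷ uxs) =
  Unique.++⁺ (Unique.map⁺ edge-injective uxs) (pairs-unique uxs) disjoint
  where
  edge-injective : ∀ {y z} → edge x y ≡ edge x z → y ≡ z
  edge-injective {y} {z} eq = Joins-injective (edge-joins x y) (subst (λ e → Joins e x z) (sym eq) (edge-joins x z))
  disjoint : ∀ {e} → ¬ (e ∈ map (edge x) xs × e ∈ pairs xs)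
  disjoint (p , q) with ∈-map⁻ (edge x) p | ∈-pairs⁻ xs q
  ... | y , _ , refl | u , v , eq , u∈ , v∈
    with Joins-end (edge-joins x y) (subst (λ e → Joins e u v) (sym eq) (edge-joins u v))
  ...   | inj₁ x≡u = ∈∷⇒≢ uq u∈ x≡u
  ...   | inj₂ x≡v = ∈∷⇒≢ uq v∈ x≡v

[1+m]C2 : ∀ m → m + m C 2 ≡ suc m C 2
[1+m]C2 m = trans (cong (_+ m C 2) (sym (nC1≡n m))) (nCk+nC[k+1]≡[n+1]C[k+1] m 1)

length-pairs : (xs : List (Fin n)) → length (pairs xs) ≡ length xs C 2
length-pairs [] = refl
length-pairs (x ∷ xs) = trans (length-++ (map (edge x) xs))
  (trans (cong (_+ length (pairs xs)) (length-map (edge x) xs))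
  (trans (cong (length xs +_) (length-pairs xs)) ([1+m]C2 (length xs))))

C2-mono : ∀ {m k} → m ≤ k → m C 2 ≤ k C 2
C2-mono z≤n = z≤n
C2-mono {suc m} {suc k} (s≤s m≤k) =
  ≤-trans (≤-reflexive (sym ([1+m]C2 m))) (≤-trans (+-mono-≤ m≤k (C2-mono m≤k)) (≤-reflexive ([1+m]C2 k)))

-- The list `pairs H` is duplicate-free and contained in `G`, so its length is a lower bound for
-- that of `G` whether or not `G` has repetitions.
clique-edges : Unique H → (∀ {i j} → i ∈ H → j ∈ H → i Fin.< j → (i , j) ∈ G) → length H C 2 ≤ edgeCount G
clique-edges {H = H} uq clique = ≤-trans (≤-reflexive (sym (length-pairs H)))
  (length-⊆ (pairs-unique uq) λ e∈ → let (lt , p , q) = pairs-ordered uq e∈ in clique p q lt)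

-- The game

-- M need only contain the missing pairs: it bounds the remaining length of the game.
Missing : ℕ → Graph n → Set
Missing m G = ∃ λ M → length M ≡ m × (∀ {e} → e ∉ G → e ∈ M)

missing : (G : Graph n) → ∃ λ m → Missing m G
missing {n} G = _ , cartesianProduct (allFin n) (allFin n) , refl ,
  λ _ → ∈-cartesianProduct⁺ (∈-allFin _) (∈-allFin _)

Missing-∷ : ∀ {m} {e : Pair n} → e ∉ G → Missing (suc m) G → Missing m (e ∷ G)
Missing-∷ {G = G} {m = m} {e = e} e∉G (M , len , M⊇) with pick (M⊇ e∉G)
... | M′ , p = M′ , suc-injective (trans (sym (↭-length p)) len) , M′⊇
  where
  M′⊇ : ∀ {f} → f ∉ e ∷ G → f ∈ M′
  M′⊇ f∉ with ∈-resp-↭ p (M⊇ (f∉ ∘ there))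
  ... | here refl = ⊥-elim (f∉ (here refl))
  ... | there f∈ = f∈

Missing-zero : Missing 0 G → ¬ ¬ (e ∈ G)
Missing-zero ([] , _ , M⊇) e∉G = case M⊇ e∉G of λ ()

Legal? : (G : Graph n) (e : Pair n) → Dec (Legal G e)
Legal? G e@(i , j) = (i Fin.<? j) ×-dec (¬? (e ∈? G) ×-dec ¬? (HasPM? (e ∷ G)))

∃Legal? : (G : Graph n) → Dec (∃ (Legal G))
∃Legal? G = map′ (λ (i , j , l) → (i , j) , l) (λ ((i , j) , l) → i , j , l)
  (Fin.any? λ i → Fin.any? λ j → Legal? G (i , j))

-- Whatever is played from G on, H is a clique when the game ends.
Good : Graph n → Set
Good {n} G = ∃ λ H → Unique H × n ∸ 4 ≤ length H ×
  (∀ {G′} → (∀ {e} → e ∈ G → e ∈ G′) → ¬ HasPM G′ →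
   ∀ {i j} → i ∈ H → j ∈ H → i Fin.< j → (i , j) ∉ G′ → ¬ HasPM ((i , j) ∷ G′))

Wins : Graph n → Player → Set
Wins {n} = MaxForces ((n ∸ 4) C 2)

Good-∷ : Good G → Good (e ∷ G)
Good-∷ (H , uq , len , safe) = H , uq , len , λ sub → safe (sub ∘ there)

-- Any pair still missing inside `H` would be a legal move, so at the end `H` is a clique and its
-- edges give the score.
good-finished : Good G → ¬ HasPM G → ¬ ∃ (Legal G) → (n ∸ 4) C 2 ≤ edgeCount {n} G
good-finished {G = G} (H , uq , len , safe) noPM noLegal = ≤-trans (C2-mono len)
  (clique-edges uq λ i∈ j∈ i<j → decidable-stable (_ ∈? G)
    λ e∉ → noLegal (_ , i<j , e∉ , safe id noPM i∈ j∈ i<j e∉))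

-- Every move preserves `Good`, so Max may play any legal edge; the number of missing pairs bounds
-- the length of play.
goodWins : Good G → ¬ HasPM G → ∀ p → Wins G p
goodWins {G = G} = go (proj₂ (missing G))
  where
  go : ∀ {n} {G : Graph n} {m} → Missing m G → Good G → ¬ HasPM G → ∀ p → Wins G p
  go {G = G} miss good noPM p with ∃Legal? G
  ... | no noLegal = finished (λ e l → noLegal (e , l)) (good-finished good noPM noLegal)
  go {m = zero} miss _ _ _ | yes (_ , _ , e∉ , _) = ⊥-elim (Missing-zero miss e∉)
  go {m = suc m} miss good noPM Max | yes (e , l@(_ , e∉ , noPM′)) =
    maxMove e l (go (Missing-∷ e∉ miss) (Good-∷ {e = e} good) noPM′ Mini)
  go {m = suc m} miss good noPM Mini | yes l =
    miniMove l λ e (_ , e∉ , noPM′) → go (Missing-∷ e∉ miss) (Good-∷ {e = e} good) noPM′ Max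

-- While Mini's moves preserve Φ, Max answers inside H; if this is impossible, H is already a clique.
tempo : (Φ : Graph n → Set) → Unique H → n ∸ 4 ≤ length H →
  (∀ {G} → Φ G → ¬ HasPM G) →
  (∀ {G i j} → Φ G → i ∈ H → j ∈ H → Φ ((i , j) ∷ G)) →
  (∀ {G} → Φ G → ∃ (Legal G)) →
  (∀ {G e} → Φ G → Legal G e → Φ (e ∷ G) ⊎ Wins (e ∷ G) Max) →
  Φ G → ∀ p → Wins G p
tempo {n = n} {H = H} {G = G₀} Φ uq len noPM quiet legal step = go (proj₂ (missing G₀))
  where
  go : ∀ {G m} → Missing m G → Φ G → ∀ p → Wins G p
  -- Under `Φ` there is always a legal move, so the missing pairs cannot run out.
  go {m = zero} miss φ _ with legal φ
  ... | _ , _ , e∉ , _ = ⊥-elim (Missing-zero miss e∉)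
  go {G = G} {m = suc m} miss φ Mini = miniMove (legal φ) λ e l@(_ , e∉ , _) →
    [ (λ φ′ → go (Missing-∷ e∉ miss) φ′ Max) , id ]′ (step φ l)
  go {G = G} {m = suc m} miss φ Max
    -- Max looks for a missing pair inside `H`. Playing it keeps `Φ`, and `Φ` excludes a perfect
    -- matching, so such a pair is legal.
    with Any.any? (λ e → (proj₁ e Fin.<? proj₂ e) ×-dec ¬? (e ∈? G)) (cartesianProduct H H)
  ... | yes found =
    let (e , e∈ , i<j , e∉) = find found
        (i∈ , j∈) = ∈-cartesianProduct⁻ H H e∈
        φ′ = quiet φ i∈ j∈
    in maxMove e (i<j , e∉ , noPM φ′) (go (Missing-∷ e∉ miss) φ′ Mini)
  ... | no complete = goodWins (H , uq , len , λ sub _ i∈ j∈ i<j e∉ _ →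
    complete (lose (∈-cartesianProduct⁺ i∈ j∈) (i<j , e∉ ∘ sub))) (noPM φ) Max

-- Moves and their position relative to the path or cycle

legalEdge : u ≢ v → ¬ Adj G u v → (∀ {e} → Joins e u v → ¬ HasPM (e ∷ G)) → Legal G (edge u v)
legalEdge {u = u} {v} {G} u≢v ¬adj noPM = edge-ordered u≢v , new (edge-joins u v) , noPM (edge-joins u v)
  where
  new : ∀ {e} → Joins e u v → e ∉ G
  new (inj₁ refl) = ¬adj ∘ inj₁
  new (inj₂ refl) = ¬adj ∘ inj₂

maxPlays : u ≢ v → ¬ Adj G u v →
  (∀ {e} → Joins e u v → ¬ HasPM (e ∷ G) × Wins (e ∷ G) Mini) → Wins G Max
maxPlays {u = u} {v} u≢v ¬adj play =
  maxMove (edge u v) (legalEdge u≢v ¬adj (proj₁ ∘ play)) (proj₂ (play (edge-joins u v)))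

-- The edge from `h` to `r` leaves `s` isolated, which blocks a perfect matching.
isolated-legal : Isolated G r → Isolated G s → r ≢ s → h ≢ r → h ≢ s → ∃ (Legal G)
isolated-legal isoR isoS r≢s h≢r h≢s = _ , legalEdge (≢-sym h≢r) (isoR _)
  λ j → isolated⇒noPM (Isolated-∷ j (≢-sym r≢s) (≢-sym h≢s) isoS)

-- Here `L` is the path or cycle, possibly with further vertices, and `R` lists other vertices,
-- mostly isolated ones. The permutations bring the touched vertices of `R` to the front, so that
-- each case has one normal form.
data Move (R L : List (Fin n)) (e : Pair n) : Set where
  inside : Joins e u v → u ≢ v → u ∈ L → v ∈ L → Move R L e
  cross  : ∀ {R′} → Joins e r h → R ↭ r ∷ R′ → h ∈ L → Move R L e
  outer  : ∀ {R′} → Joins e r s → R ↭ r ∷ s ∷ R′ → Move R L e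

move : R ++ L ↭ allFin n → {i j : Fin n} → i Fin.< j → Move R L (i , j)
move {R = R} part {i} {j} i<j with ∈-++⁻ R (∈-all part i) | ∈-++⁻ R (∈-all part j)
... | inj₂ i∈L | inj₂ j∈L = inside (inj₁ refl) (Fin.<⇒≢ i<j) i∈L j∈L
... | inj₁ i∈R | inj₂ j∈L = cross (inj₁ refl) (proj₂ (pick i∈R)) j∈L
... | inj₂ i∈L | inj₁ j∈R = cross (inj₂ refl) (proj₂ (pick j∈R)) i∈L
... | inj₁ i∈R | inj₁ j∈R with pick i∈R
...   | R′ , p with ∈-resp-↭ p j∈R
...     | here refl = ⊥-elim (Fin.<-irrefl refl i<j)
...     | there j∈R′ with pick j∈R′
...       | R″ , q = outer (inj₁ refl) (↭-trans p (prep i q))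

part-R : ∀ {R′} → R ↭ R′ → R ++ L ↭ xs → R′ ++ L ↭ xs
part-R p part = ↭-trans (++⁺ʳ _ (↭-sym p)) part

part-L : ∀ R {L′} → L′ ↭ L → R ++ L ↭ xs → R ++ L′ ↭ xs
part-L R p part = ↭-trans (++⁺ˡ R p) part

part-move : ∀ R {L′ : List (Fin n)} → L′ ↭ r ∷ L → r ∷ R ++ L ↭ xs → R ++ L′ ↭ xs
part-move R p part = ↭-trans (++⁺ˡ R p) (↭-trans (shift _ R _) part)

apart : ∀ R → Unique (R ++ L) → r ∈ R → h ∈ L → r ≢ h
apart (_ ∷ R) uq (here refl) h∈ = ∈∷⇒≢ uq (∈-++⁺ʳ R h∈)
apart (_ ∷ R) (_ ∷ uq) (there r∈) h∈ = apart R uq r∈ h∈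

-- Cycles

-- A closed walk with its first vertex repeated at the end. Distinctness of the vertices comes from
-- the partition of the vertex set; two adjacent vertices already count as a cycle.
Cycle : Graph n → List (Fin n) → Set
Cycle G [] = ⊥
Cycle G (x ∷ xs) = Linked (Adj G) (x ∷ xs ++ x ∷ [])

Path-mono : (∀ {e} → e ∈ G → e ∈ G′) → Linked (Adj G) xs → Linked (Adj G′) xs
Path-mono sub = Linked.map (Adj-mono sub)

Cycle-mono : (∀ {e} → e ∈ G → e ∈ G′) → Cycle G xs → Cycle G′ xs
Cycle-mono {xs = x ∷ xs} = Path-mono

Cycle⇒Path : Cycle G xs → Linked (Adj G) xs
Cycle⇒Path {xs = x ∷ xs} = Linked-init (x ∷ xs)

Path⇒Cycle : ∀ ys → Linked (Adj G) (x ∷ ys ∷ʳ y) → Adj G y x → Cycle G (x ∷ ys ∷ʳ y)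
Path⇒Cycle {x = x} {y} ys l adj = subst (Linked (Adj _)) (sym (++-assoc (x ∷ ys) (y ∷ []) (x ∷ [])))
  (Linked-++⁺ (x ∷ ys) l (adj ∷ [-]))

-- The closed walk is cut at `h` and at its first vertex, and the two halves are exchanged.
rotate : Cycle G L → h ∈ L → ∃ λ xs → Cycle G (h ∷ xs) × h ∷ xs ↭ L
rotate cyc h∈ with ∈-∃++ h∈
... | [] , bs , refl = bs , cyc , ↭-refl
rotate {G = G} {h = h} cyc h∈ | x ∷ as , bs , refl = bs ++ x ∷ as , cyc′ , ++-comm (h ∷ bs) (x ∷ as)
  where
  halves : Linked (Adj G) (x ∷ as ++ h ∷ []) × Linked (Adj G) (h ∷ bs ++ x ∷ [])
  halves = Linked-++⁻ (x ∷ as) (subst (Linked (Adj G)) (++-assoc (x ∷ as) (h ∷ bs) (x ∷ [])) cyc)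
  cyc′ : Linked (Adj G) (h ∷ (bs ++ x ∷ as) ++ h ∷ [])
  cyc′ = subst (Linked (Adj G)) (sym (++-assoc (h ∷ bs) (x ∷ as) (h ∷ [])))
           (Linked-++⁺ (h ∷ bs) (proj₂ halves) (proj₁ halves))

-- Removing one vertex from an odd cycle leaves a path on an even number of vertices. This is what
-- makes odd cycles useful to Max.
Cycle⇒Matched-tail : Cycle G (h ∷ xs) → 2 ∣ length xs → Matched G xs
Cycle⇒Matched-tail cyc = evenPath⇒Matched (Linked.tail (Cycle⇒Path cyc))

listOf1 : ∀ (xs : List A) → length xs ≡ 1 → ∃ λ x → xs ≡ x ∷ []
listOf1 (x ∷ []) _ = x , refl

listOf2 : ∀ (xs : List A) → length xs ≡ 2 → ∃ λ x → ∃ λ y → xs ≡ x ∷ y ∷ []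
listOf2 (x ∷ y ∷ []) _ = x , y , refl

listOf3 : ∀ (xs : List A) → length xs ≡ 3 → ∃ λ x → ∃ λ y → ∃ λ z → xs ≡ x ∷ y ∷ z ∷ []
listOf3 (x ∷ y ∷ z ∷ []) _ = x , y , z , refl

↭-length-∷ : ∀ {m} → length xs ≡ suc m → xs ↭ x ∷ ys → length ys ≡ m
↭-length-∷ len p = suc-injective (trans (sym (↭-length p)) len)

↭-length-∷∷ : ∀ {m} → length xs ≡ suc (suc m) → xs ↭ x ∷ y ∷ ys → length ys ≡ m
↭-length-∷∷ len p = suc-injective (suc-injective (trans (sym (↭-length p)) len))

Unique-∷-++ʳ : ∀ (xs : List A) → Unique (x ∷ xs ++ ys) → Unique (x ∷ ys)
Unique-∷-++ʳ xs (px ∷ u) = All.++⁻ʳ xs px ∷ Unique-++ʳ xs u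

isolated-inside : Unique (R ++ L) → Joins e u v → u ∈ L → v ∈ L →
                  All (Isolated G) R → All (Isolated (e ∷ G)) R
isolated-inside {R = R} uq j u∈ v∈ isos = All.tabulate λ t∈ →
  Isolated-∷ j (apart R uq t∈ u∈) (apart R uq t∈ v∈) (All.lookup isos t∈)

isolated-cross : Unique (r ∷ R ++ L) → Joins e r h → h ∈ L →
                 All (Isolated G) R → All (Isolated (e ∷ G)) R
isolated-cross {R = R} uq@(_ ∷ uq′) j h∈ isos = All.tabulate λ t∈ →
  Isolated-∷ j (≢-sym (∈∷⇒≢ uq (∈-++⁺ˡ t∈))) (apart R uq′ t∈ h∈) (All.lookup isos t∈)

isolated-outer : Unique (r ∷ s ∷ R ++ L) → Joins e r s →
                 All (Isolated G) R → All (Isolated (e ∷ G)) R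
isolated-outer uq@(_ ∷ uq′) j isos = All.tabulate λ t∈ →
  Isolated-∷ j (≢-sym (∈∷⇒≢ uq (there (∈-++⁺ˡ t∈)))) (≢-sym (∈∷⇒≢ uq′ (∈-++⁺ˡ t∈))) (All.lookup isos t∈)

-- If the ends of the path are already adjacent, Max still has the move. Otherwise the closing edge
-- uses it up, and `r` stays isolated. Hence two continuations with different players to move.
closeCycle : Linked (Adj G) L → Unique L → 2 ≤ length L → Isolated G r → (∀ {u} → u ∈ L → r ≢ u) →
  (∀ {e u v} → Joins e u v → u ∈ L → v ∈ L → Cycle (e ∷ G) L → Wins (e ∷ G) Mini) →
  (Cycle G L → Wins G Max) → Wins G Max
closeCycle {L = x ∷ xs} l uq 2≤ iso r∉L play closed with initLast xs
closeCycle {L = x ∷ _} l uq (s≤s ()) iso r∉L play closed | []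
closeCycle {G = G} {L = x ∷ _} l uq 2≤ iso r∉L play closed | ys ∷ʳ′ y with Adj? G y x
... | yes adj = closed (Path⇒Cycle ys l adj)
... | no ¬adj = maxPlays (≢-sym (∈∷⇒≢ uq y∈)) ¬adj λ j →
    isolated⇒noPM (Isolated-∷ j (r∉L (there y∈)) (r∉L (here refl)) iso) ,
    play j (there y∈) (here refl) (Path⇒Cycle ys (Path-mono there l) (Adj-here j))
  where
  y∈ : y ∈ ys ∷ʳ y
  y∈ = ∈-++⁺ʳ ys (here refl)

rotate₂ : Cycle G L → 2 ≤ length L → h ∈ L → ∃ λ h′ → ∃ λ xs → Cycle G (h ∷ h′ ∷ xs) × h ∷ h′ ∷ xs ↭ L
rotate₂ cyc 2≤ h∈ with rotate cyc h∈
... | [] , _ , p = case subst (2 ≤_) (sym (↭-length p)) 2≤ of λ { (s≤s ()) }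
... | h′ ∷ xs , cyc′ , p = h′ , xs , cyc′ , p

-- With `r` joined to `h`, Max joins it to the successor `h′` of `h` and replaces the cycle edge
-- from `h` to `h′` by the detour through `r`. The condition on the neighbours of `r` makes the edge
-- new.
extendCycle : Cycle G L → 2 ≤ length L → Unique (r ∷ L) → Adj G r h → h ∈ L →
  (∀ {u} → u ∈ L → Adj G r u → u ≡ h) →
  (∀ {e h′ L′} → Joins e r h′ → h′ ∈ L → L′ ↭ r ∷ L → Cycle (e ∷ G) L′ →
    ¬ HasPM (e ∷ G) × Wins (e ∷ G) Mini) →
  Wins G Max
extendCycle cyc 2≤ uq rh h∈ only play with rotate₂ cyc 2≤ h∈
... | h′ , xs , hh′ ∷ l , p = maxPlays (∈∷⇒≢ uq h′∈) (λ rh′ → h≢h′ (sym (only h′∈ rh′))) λ j →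
    play j h′∈ (↭-trans (swap _ _ ↭-refl) (prep _ p))
      (Adj-there (Adj-sym rh) ∷ Adj-here j ∷ Path-mono there l)
  where
  h′∈ : h′ ∈ _
  h′∈ = ∈-resp-↭ p (there (here refl))
  h≢h′ : _ ≢ h′
  h≢h′ = ∈∷⇒≢ (Unique-resp-↭ (↭-sym p) (Unique-tail uq)) (here refl)

-- Mini's edge to the cycle is completed to a detour through `r`, so the parity of the cycle
-- changes. The vertex `t` remains isolated throughout and blocks a perfect matching.
absorb : ∀ {t} → Cycle G L → 2 ≤ length L → r ∷ t ∷ R ++ L ↭ allFin n → Isolated G r → Isolated G t →
  Joins e r h → h ∈ L →
  (∀ {e′ h′ L′} → Joins e′ r h′ → h′ ∈ L → t ∷ R ++ L′ ↭ allFin n → Cycle (e′ ∷ e ∷ G) L′ →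
    ¬ HasPM (e′ ∷ e ∷ G) → Wins (e′ ∷ e ∷ G) Mini) →
  Wins (e ∷ G) Max
absorb {R = R} {t = t} cyc 2≤ part isoR isoT j h∈ play =
  extendCycle (Cycle-mono there cyc) 2≤ uqL (Adj-here j) h∈
    (λ u∈ → NbrsIn-new j (∈∷⇒≢ uqL h∈) (Isolated⇒NbrsIn isoR) _)
    λ j′ h′∈ p cyc′ →
      let noPM = isolated⇒noPM (Isolated-∷ j′ t≢r (t∉L h′∈) (Isolated-∷ j t≢r (t∉L h∈) isoT))
      in noPM , play j′ h′∈ (part-move (t ∷ R) p part) cyc′ noPM
  where
  uq = allUnique part
  uqL = Unique-∷-++ʳ (t ∷ R) uq
  t≢r = ≢-sym (∈∷⇒≢ uq (here refl))
  t∉L : ∀ {u} → u ∈ _ → t ≢ u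
  t∉L u∈ = ∈∷⇒≢ (Unique-tail uq) (∈-++⁺ʳ R u∈)

-- The path is cut just before `h`. The new path runs through the first piece backwards to `x`, then
-- to `r` by Max's edge, to `h`, and along the second piece.
reroute : Linked (Adj G) (x ∷ xs) → h ∈ xs → Unique (r ∷ x ∷ xs) → Adj G r h → NbrsIn G r h →
  (∀ {e L′} → Joins e r x → L′ ↭ r ∷ x ∷ xs → Linked (Adj (e ∷ G)) L′ →
    ¬ HasPM (e ∷ G) × Wins (e ∷ G) Mini) →
  Wins G Max
reroute {x = x} l h∈ uq rh only play with ∈-∃++ h∈
... | as , bs , refl = maxPlays (∈∷⇒≢ uq (here refl))
    (λ rx → ∈∷⇒≢ (Unique-tail uq) (∈-++⁺ʳ as (here refl)) (only _ rx)) λ j →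
    play j (↭-trans (↭-sym (++↭ʳ++ (x ∷ as) _)) (shift _ (x ∷ as) _))
      (Linked-ʳ++ Adj-sym (Adj-sym (Adj-here j)) (Path-mono there (Linked-init (x ∷ as) (proj₁ halves)))
        (Adj-there rh ∷ Path-mono there (proj₂ halves)))
  where
  halves = Linked-++⁻ (x ∷ as) l

-- Max's strategy

module Strategy {n : ℕ} (8≤n : 8 ≤ n) (2∣n : 2 ∣ n) where

  even-length : xs ↭ allFin n → 2 ∣ length xs
  even-length p = subst (2 ∣_) (sym (trans (↭-length p) (length-tabulate id))) 2∣n

  even-pred : ∀ {m} → 2 ∣ 2 + m → 2 ∣ m
  even-pred even = ∣m+n∣m⇒∣n even ∣-refl

  cycle-length : ∀ R → length R ≤ 4 → R ++ L ↭ allFin n → n ∸ 4 ≤ length L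
  cycle-length {L = L} R R≤4 part = ≤-trans (∸-monoˡ-≤ 4 n≤) (≤-reflexive (m+n∸m≡n 4 (length L)))
    where
    n≤ : n ≤ 4 + length L
    n≤ = ≤-trans (≤-reflexive (sym (trans (sym (length-++ R)) (trans (↭-length part) (length-tabulate id)))))
                 (+-monoˡ-≤ (length L) R≤4)

  2≤length : ∀ {m} → n ∸ 4 ≤ m → 2 ≤ m
  2≤length len = ≤-trans (s≤s (s≤s z≤n)) (≤-trans (∸-monoˡ-≤ 4 8≤n) len)

  nonempty : n ∸ 4 ≤ length L → ∃ (_∈ L)
  nonempty {L = []} len = case 2≤length len of λ ()
  nonempty {L = x ∷ _} _ = x , here refl

  -- Odd cycles

  -- The vertex d can only be matched into the odd cycle, which has a perfect matching once any one vertex is removed.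
  good-oddCycle₁ : Cycle G L → d ∷ L ↭ allFin n → Good G
  good-oddCycle₁ {G = G} {L} {d} cyc part =
    L , Unique-tail uq , cycle-length (d ∷ []) (s≤s z≤n) part , safe
    where
    uq = allUnique part
    safe : ∀ {G′} → (∀ {e} → e ∈ G → e ∈ G′) → ¬ HasPM G′ →
           ∀ {i j} → i ∈ L → j ∈ L → i Fin.< j → (i , j) ∉ G′ → ¬ HasPM ((i , j) ∷ G′)
    safe sub noPM i∈ j∈ _ _ (μ , _ , irr , adj) with ∈-all part (μ d)
    ... | here μd≡d = irr d μd≡d
    ... | there w∈ with rotate cyc w∈
    ...   | xs , cyc′ , p = noPM (Matched⇒HasPM
              (pair (Adj-∷⁻-avoid (inj₁ refl) (∈∷⇒≢ uq i∈) (∈∷⇒≢ uq j∈) (adj d))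
                    (Cycle⇒Matched-tail (Cycle-mono sub cyc′) (even-pred (even-length part′)))) part′)
      where part′ = part-L (d ∷ []) p part

  -- A chord touches none of `a`, `b`, `c`. Given a perfect matching after the chord is added,
  -- exactly one edge among these three and one edge from the remaining one into the cycle can be
  -- chosen without the chord; the rest of the odd cycle is then an even path. So there was a
  -- perfect matching before.
  good-oddCycle₃ : Cycle G L → a ∷ b ∷ c ∷ L ↭ allFin n → Adj G a b → Good G
  good-oddCycle₃ {G = G} {L} {a} {b} {c} cyc part ab =
    L , Unique-++ʳ (a ∷ b ∷ c ∷ []) uq , cycle-length (a ∷ b ∷ c ∷ []) (s≤s (s≤s (s≤s z≤n))) part , safe
    where
    uq = allUnique part

    safe : ∀ {G′} → (∀ {e} → e ∈ G → e ∈ G′) → ¬ HasPM G′ →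
           ∀ {i j} → i ∈ L → j ∈ L → i Fin.< j → (i , j) ∉ G′ → ¬ HasPM ((i , j) ∷ G′)
    safe {G′} sub noPM {i} {j} i∈ j∈ _ _ (μ , inv , irr , adj) = third (∈-all part (μ c))
      where
      outside : ∀ {r} → r ∈ a ∷ b ∷ c ∷ [] → Adj G′ r (μ r)
      outside r∈ = Adj-∷⁻-avoid (inj₁ refl) (apart _ uq r∈ i∈) (apart _ uq r∈ j∈) (adj _)

      finish : ∀ {p q r} → p ∷ q ∷ r ∷ L ↭ allFin n → Adj G′ p q → Adj G′ r (μ r) → μ r ∈ L → ⊥
      finish {p} {q} {r} part pq rw w∈ with rotate cyc w∈
      ... | xs , cyc′ , perm = noPM (Matched⇒HasPM
              (pair pq (pair rw (Cycle⇒Matched-tail (Cycle-mono sub cyc′)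
                (even-pred (even-pred (even-length part′)))))) part′)
        where part′ = part-L (p ∷ q ∷ r ∷ []) perm part

      -- If c is matched to p ∈ {a , b}, the other vertex q of {a , b} is matched into the cycle.
      matchedTo : ∀ {p q} → p ∷ q ∷ c ∷ L ↭ allFin n → q ∈ a ∷ b ∷ c ∷ [] → μ c ≡ p → ⊥
      matchedTo {p} {q} part q∈ μc≡p with ∈-all part (μ q)
      ... | here μq≡p = ∈∷⇒≢ (Unique-tail (allUnique part)) (here refl)
              (trans (sym (inv q)) (trans (cong μ (trans μq≡p (sym μc≡p))) (inv c)))
      ... | there (here μq≡q) = irr q μq≡q
      ... | there (there (here μq≡c)) = ∈∷⇒≢ (allUnique part) (here refl)
              (trans (sym μc≡p) (trans (cong μ (sym μq≡c)) (inv q)))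
      ... | there (there (there w∈)) = finish (↭-trans (prep p (swap c q ↭-refl)) part)
              (subst (λ w → Adj G′ w c) μc≡p (Adj-sym (outside (there (there (here refl)))))) (outside q∈) w∈

      third : μ c ∈ a ∷ b ∷ c ∷ L → ⊥
      third (here μc≡a) = matchedTo part (there (here refl)) μc≡a
      third (there (here μc≡b)) = matchedTo (↭-trans (swap b a ↭-refl) part) (here refl) μc≡b
      third (there (there (here μc≡c))) = irr c μc≡c
      third (there (there (there w∈))) = finish part (Adj-mono sub ab) (outside (there (there (here refl)))) w∈

  -- Max makes sure that `a` and `b` are adjacent; the isolated `c` keeps this safe.
  oddCycle₃-max : Cycle G L → a ∷ b ∷ c ∷ L ↭ allFin n → Isolated G c → Wins G Max
  oddCycle₃-max {G = G} {a = a} {b} cyc part isoC with Adj? G a b | allUnique part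
  ... | yes ab | _ = goodWins (good-oddCycle₃ cyc part ab) (isolated⇒noPM isoC) Max
  ... | no ¬ab | uq@(_ ∷ uq′) = maxPlays (∈∷⇒≢ uq (here refl)) ¬ab λ j →
    let noPM = isolated⇒noPM (Isolated-∷ j (≢-sym (∈∷⇒≢ uq (there (here refl)))) (≢-sym (∈∷⇒≢ uq′ (here refl))) isoC)
    in noPM , goodWins (good-oddCycle₃ (Cycle-mono there cyc) part (Adj-here j)) noPM Mini

  -- Unless Mini plays the edge between `b` and `c`, which is good for Max at once, one of these two
  -- stays isolated and Max can provide the edge from `a` to the other.
  oddCycle₃-mini : Cycle G L → a ∷ b ∷ c ∷ L ↭ allFin n → Isolated G b → Isolated G c → Wins G Mini
  oddCycle₃-mini {G = G} {L} {a} {b} {c} cyc part isoB isoC = miniMove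
      (isolated-legal isoB isoC b≢c a≢b (∈∷⇒≢ uq (there (here refl)))) reply
    where
    uq = allUnique part
    a≢b = ∈∷⇒≢ uq (here refl)
    b≢c = ∈∷⇒≢ (Unique-tail uq) (here refl)

    touchesB : ∀ {e w} → Joins e b w → ¬ HasPM (e ∷ G) → Wins (e ∷ G) Max
    touchesB {w = w} j noPM with w Fin.≟ c
    ... | yes refl = goodWins (good-oddCycle₃ (Cycle-mono there cyc)
                       (↭-trans (shift a (b ∷ c ∷ []) L) part) (Adj-here j)) noPM Max
    ... | no w≢c = oddCycle₃-max (Cycle-mono there cyc) part (Isolated-∷ j (≢-sym b≢c) (≢-sym w≢c) isoC)

    reply : ∀ e → Legal G e → Wins (e ∷ G) Max
    reply (i , j) (_ , _ , noPM) with b Fin.≟ i | b Fin.≟ j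
    ... | yes refl | _ = touchesB (inj₁ refl) noPM
    ... | no _ | yes refl = touchesB (inj₂ refl) noPM
    ... | no b≢i | no b≢j = oddCycle₃-max (Cycle-mono there cyc)
            (↭-trans (prep a (swap c b ↭-refl)) part) (Isolated-∷ (inj₁ refl) b≢i b≢j isoB)

  -- Even cycles

  -- The edge between `r` and `s` would complete a perfect matching together with alternate edges of
  -- the cycle. Mini can therefore leave the cycle only by an edge into it, and absorbing that
  -- vertex gives an odd cycle missing one vertex.
  evenCycle₂ : Cycle G L → r ∷ s ∷ L ↭ allFin n → Isolated G r → Isolated G s → ∀ p → Wins G p
  evenCycle₂ {L = L} {r} {s} cyc part isoR isoS = tempo Φ uqL len
      (λ { (_ , isoR ∷ _) → isolated⇒noPM isoR })
      (λ (cyc , isos) i∈ j∈ → Cycle-mono there cyc , isolated-inside uq (inj₁ refl) i∈ j∈ isos)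
      legal step (cyc , isoR ∷ isoS ∷ [])
    where
    Φ : Graph n → Set
    Φ G = Cycle G L × All (Isolated G) (r ∷ s ∷ [])
    uq = allUnique part
    uqL = Unique-++ʳ (r ∷ s ∷ []) uq
    len = cycle-length (r ∷ s ∷ []) (s≤s (s≤s z≤n)) part

    legal : ∀ {G} → Φ G → ∃ (Legal G)
    legal (_ , isoR ∷ isoS ∷ []) = let (h , h∈) = nonempty len in
      isolated-legal isoR isoS (∈∷⇒≢ uq (here refl))
        (≢-sym (∈∷⇒≢ uq (there h∈))) (≢-sym (∈∷⇒≢ (Unique-tail uq) h∈))

    step : ∀ {G e} → Φ G → Legal G e → Φ (e ∷ G) ⊎ Wins (e ∷ G) Max
    step (cyc , isos) (i<j , _ , noPM) with move {R = r ∷ s ∷ []} part i<j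
    ... | inside j _ u∈ v∈ = inj₁ (Cycle-mono there cyc , isolated-inside uq j u∈ v∈ isos)
    ... | outer {R′ = []} j p = ⊥-elim (noPM (Matched⇒HasPM
            (pair (Adj-here j) (evenPath⇒Matched (Cycle⇒Path (Cycle-mono there cyc)) (even-pred (even-length part))))
            (part-R p part)))
    ... | outer {R′ = _ ∷ _} j p = case ↭-length p of λ ()
    ... | cross {R′ = R′} j p h∈ with listOf1 R′ (↭-length-∷ refl p)
    ...   | t , refl with All-resp-↭ p isos
    ...     | isoR′ ∷ isoT ∷ [] = inj₂ (absorb {R = []} cyc (2≤length len) (part-R p part) isoR′ isoT j h∈
              λ _ _ part′ cyc′ noPM′ → goodWins (good-oddCycle₁ cyc′ part′) noPM′ Mini)

  -- Three vertices hang off a, so no perfect matching arises as long as two of them remain leaves.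
  star : Cycle G L → R ++ a ∷ L ↭ allFin n → length R ≡ 3 →
         All (λ r → NbrsIn G r a × Adj G r a) R → ∀ p → Wins G p
  star {L = L} {R} {a} cyc part |R|≡3 leaves with listOf3 R |R|≡3
  ... | r₁ , r₂ , r₃ , refl = tempo Φ uqL len
      (λ { (_ , (leaf₁ , _) ∷ (leaf₂ , _) ∷ _) → twoLeaves⇒noPM leaf₁ leaf₂ (∈∷⇒≢ uq (here refl)) })
      (λ (cyc , leaves) i∈ j∈ → Cycle-mono there cyc , leaves-inside (inj₁ refl) i∈ j∈ leaves)
      legal step (cyc , leaves)
    where
    R₃ = r₁ ∷ r₂ ∷ r₃ ∷ []
    Leaf : Graph n → Fin n → Set
    Leaf G r = NbrsIn G r a × Adj G r a
    Φ : Graph n → Set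
    Φ G = Cycle G L × All (Leaf G) R₃
    uq = allUnique part
    uqL = Unique-++ʳ R₃ uq
    lenL = cycle-length (r₁ ∷ r₂ ∷ r₃ ∷ a ∷ []) ≤-refl part
    len : n ∸ 4 ≤ length (a ∷ L)
    len = ≤-trans lenL (n≤1+n _)

    leaves-inside : ∀ {G e u v} → Joins e u v → u ∈ a ∷ L → v ∈ a ∷ L → All (Leaf G) R₃ → All (Leaf (e ∷ G)) R₃
    leaves-inside j u∈ v∈ leaves = All.tabulate λ r∈ → let (only , ra) = All.lookup leaves r∈ in
      NbrsIn-∷ j (apart R₃ uq r∈ u∈) (apart R₃ uq r∈ v∈) only , Adj-there ra

    leaves-center : ∀ {G e r} → Joins e r a → All (Leaf G) R₃ → All (Leaf (e ∷ G)) R₃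
    leaves-center j leaves = All.tabulate λ r∈ → let (only , ra) = All.lookup leaves r∈ in
      NbrsIn-new j (apart R₃ uq r∈ (here refl)) only , Adj-there ra

    legal : ∀ {G} → Φ G → ∃ (Legal G)
    legal (_ , (leaf₁ , _) ∷ (leaf₂ , _) ∷ (leaf₃ , _) ∷ []) =
      let (h , h∈) = nonempty lenL in
      -- After this edge `r₂` and `r₃` are still leaves at `a`.
      edge r₁ h , legalEdge (apart R₃ uq (here refl) (there h∈))
        (λ adj → ∈∷⇒≢ uqL h∈ (sym (leaf₁ h adj)))
        λ j → twoLeaves⇒noPM
          (NbrsIn-∷ j (≢-sym (∈∷⇒≢ uq (here refl))) (apart R₃ uq (there (here refl)) (there h∈)) leaf₂)
          (NbrsIn-∷ j (≢-sym (∈∷⇒≢ uq (there (here refl)))) (apart R₃ uq (there (there (here refl))) (there h∈)) leaf₃)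
          (∈∷⇒≢ (Unique-tail uq) (here refl))

    -- The leaf `r` is inserted into the cycle, which becomes odd; outside it remain `a`, `s`, `t`
    -- with an edge from `a` to `s`. The leaves `s` and `t` still exclude a perfect matching.
    leafJoinsCycle : ∀ {G e r s t h} → Cycle G L → r ∷ s ∷ t ∷ a ∷ L ↭ allFin n → Leaf G r → Leaf G s → Leaf G t →
                     Joins e r h → h ∈ L → Wins (e ∷ G) Max
    leafJoinsCycle {G} {e} {r} {s} {t} {h} cyc part (onlyR , _) (onlyS , sa) (onlyT , _) j h∈ =
      extendCycle (Cycle-mono there cyc) (2≤length lenL) (Unique-∷-++ʳ (s ∷ t ∷ a ∷ []) uq′) (Adj-here j) h∈ only
        λ j′ h′∈ p cyc′ →
          let noPM = twoLeaves⇒noPM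
                (NbrsIn-∷ j′ (≢-sym r≢s) (s≢ h′∈) (NbrsIn-∷ j (≢-sym r≢s) (s≢ h∈) onlyS))
                (NbrsIn-∷ j′ (≢-sym r≢t) (t≢ h′∈) (NbrsIn-∷ j (≢-sym r≢t) (t≢ h∈) onlyT))
                (∈∷⇒≢ (Unique-tail uq′) (here refl))
          in noPM , goodWins (good-oddCycle₃ cyc′
               (↭-trans (↭-sym (shift a (s ∷ t ∷ []) _)) (part-move (s ∷ t ∷ a ∷ []) p part))
               (Adj-sym (Adj-there (Adj-there sa)))) noPM Mini
      where
      uq′ = allUnique part
      r≢s = ∈∷⇒≢ uq′ (here refl)
      r≢t = ∈∷⇒≢ uq′ (there (here refl))
      s≢ : ∀ {u} → u ∈ L → s ≢ u
      s≢ u∈ = ∈∷⇒≢ (Unique-tail uq′) (there (there u∈))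
      t≢ : ∀ {u} → u ∈ L → t ≢ u
      t≢ u∈ = ∈∷⇒≢ (Unique-tail (Unique-tail uq′)) (there u∈)
      only : ∀ {u} → u ∈ L → Adj (e ∷ G) r u → u ≡ h
      only u∈ adj with Adj-∷⁻ j adj
      ... | inj₁ (inj₁ (_ , u≡h)) = u≡h
      ... | inj₁ (inj₂ (r≡h , _)) = ⊥-elim (∈∷⇒≢ uq′ (there (there (there h∈))) r≡h)
      ... | inj₂ adj′ = ⊥-elim (∈∷⇒≢ uqL u∈ (sym (onlyR _ adj′)))

    step : ∀ {G e} → Φ G → Legal G e → Φ (e ∷ G) ⊎ Wins (e ∷ G) Max
    step (cyc , leaves) (i<j , _ , noPM) with move {R = R₃} part i<j
    ... | inside j _ u∈ v∈ = inj₁ (Cycle-mono there cyc , leaves-inside j u∈ v∈ leaves)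
    ... | cross j p (here refl) = inj₁ (Cycle-mono there cyc , leaves-center j leaves)
    ... | cross {R′ = R′} j p (there h∈) with listOf2 R′ (↭-length-∷ refl p)
    ...   | s , t , refl with All-resp-↭ p leaves
    ...     | leafR ∷ leafS ∷ leafT ∷ [] = inj₂ (leafJoinsCycle cyc (part-R p part) leafR leafS leafT j h∈)
    step (cyc , leaves) (i<j , _ , noPM) | outer {R′ = R′} j p with listOf1 R′ (↭-length-∷∷ refl p)
    ...   | t , refl with All-resp-↭ p leaves
    -- An edge between two leaves, the edge from the third leaf to `a` and alternate cycle edges
    -- would form a perfect matching.
    ...     | _ ∷ _ ∷ (_ , ta) ∷ [] = ⊥-elim (noPM (Matched⇒HasPM
              (pair (Adj-here j) (pair (Adj-there ta) (evenPath⇒Matched (Cycle⇒Path (Cycle-mono there cyc))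
                (even-pred (even-pred (even-length part)))))) (part-R p part)))

  -- Max's replies when an edge and two isolated vertices lie outside an even cycle. Only `b` is
  -- restricted in its neighbours, and the roles of `a` and `b` are exchanged when Mini plays at the
  -- other end.
  module _ {a b : Fin n} (ab : Adj G a b) (onlyB : NbrsIn G b a) (cyc : Cycle G L)
           (part : r ∷ s ∷ a ∷ b ∷ L ↭ allFin n) (isoR : Isolated G r) (isoS : Isolated G s) where

    private
      uq = allUnique part
      lenL = cycle-length (r ∷ s ∷ a ∷ b ∷ []) ≤-refl part
      r≢s = ∈∷⇒≢ uq (here refl)
      r≢a = ∈∷⇒≢ uq (there (here refl))
      r≢b = ∈∷⇒≢ uq (there (there (here refl)))
      s≢a = ∈∷⇒≢ (Unique-tail uq) (here refl)
      s≢b = ∈∷⇒≢ (Unique-tail uq) (there (here refl))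
      a≢b = ∈∷⇒≢ (Unique-++ʳ (r ∷ s ∷ []) uq) (here refl)
      r≢ : ∀ {u} → u ∈ L → r ≢ u
      r≢ u∈ = ∈∷⇒≢ uq (there (there (there u∈)))
      s≢ : ∀ {u} → u ∈ L → s ≢ u
      s≢ u∈ = ∈∷⇒≢ (Unique-tail uq) (there (there u∈))
      a≢ : ∀ {u} → u ∈ L → a ≢ u
      a≢ u∈ = ∈∷⇒≢ (Unique-++ʳ (r ∷ s ∷ []) uq) (there u∈)
      b≢ : ∀ {u} → u ∈ L → b ≢ u
      b≢ u∈ = ∈∷⇒≢ (Unique-++ʳ (r ∷ s ∷ a ∷ []) uq) u∈

    -- After Mini's edge, `r` and `b` hang off `a`; Max adds `s` as the third leaf.
    completeStar : Joins e r a → Wins (e ∷ G) Max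
    completeStar j = maxPlays s≢a (Isolated-∷ j (≢-sym r≢s) s≢a isoS a) λ j′ →
      let leafR = NbrsIn-∷ j′ r≢s r≢a (NbrsIn-new j r≢a (Isolated⇒NbrsIn isoR))
          leafS = NbrsIn-new j′ s≢a (NbrsIn-∷ j (≢-sym r≢s) s≢a (Isolated⇒NbrsIn isoS))
          leafB = NbrsIn-∷ j′ (≢-sym s≢b) (≢-sym a≢b) (NbrsIn-∷ j (≢-sym r≢b) (≢-sym a≢b) onlyB)
      in twoLeaves⇒noPM leafR leafS r≢s ,
         star {R = r ∷ s ∷ b ∷ []} (Cycle-mono (there ∘ there) cyc)
           (↭-trans (prep r (prep s (swap b a ↭-refl))) part) refl
           ((leafR , Adj-there (Adj-here j)) ∷ (leafS , Adj-here j′) ∷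
            (leafB , Adj-there (Adj-there (Adj-sym ab))) ∷ []) Mini

    -- The cycle edge from `h` to `h′` is replaced by the path through `a` and `b`. The cycle stays
    -- even, and only `r` and `s` remain outside.
    insertEdge : Joins e a h → h ∈ L → Wins (e ∷ G) Max
    insertEdge {h = h} j h∈ with rotate₂ cyc (2≤length lenL) h∈
    ... | h′ , xs , hh′ ∷ l , p = maxPlays (b≢ h′∈)
        (λ bh′ → a≢ h′∈ (sym (onlyB _ (Adj-∷⁻-avoid j (≢-sym a≢b) (b≢ h∈) bh′)))) λ j′ →
        let isoR′ = Isolated-∷ j′ r≢b (r≢ h′∈) (Isolated-∷ j r≢a (r≢ h∈) isoR)
            isoS′ = Isolated-∷ j′ s≢b (s≢ h′∈) (Isolated-∷ j s≢a (s≢ h∈) isoS)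
        in isolated⇒noPM isoR′ ,
           evenCycle₂
             (Adj-there (Adj-sym (Adj-here j)) ∷ Adj-there (Adj-there ab) ∷ Adj-here j′ ∷ Path-mono (there ∘ there) l)
             (part-L (r ∷ s ∷ []) (↭-trans (↭-sym (shift h (a ∷ b ∷ []) (h′ ∷ xs))) (prep a (prep b p))) part)
             isoR′ isoS′ Mini
      where
      h′∈ : h′ ∈ L
      h′∈ = ∈-resp-↭ p (there (here refl))

    -- The cycle becomes odd with `s`, `a`, `b` outside, and the edge between `a` and `b` is already
    -- there.
    absorbIsolated : Joins e r h → h ∈ L → Wins (e ∷ G) Max
    absorbIsolated j h∈ = absorb {R = a ∷ b ∷ []} cyc (2≤length lenL) part isoR isoS j h∈
      λ {_} {_} {L′} _ _ part′ cyc′ noPM → goodWins (good-oddCycle₃ cyc′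
        (↭-trans (shift s (a ∷ b ∷ []) L′) part′) (Adj-there (Adj-there ab))) noPM Mini

  -- The edge between `r` and `s` would complete a perfect matching. Chords preserve `Φ`, and every
  -- other way to touch the outside vertices is met by one of the three replies above.
  evenCycle-edge : Cycle G L → r ∷ s ∷ a ∷ b ∷ L ↭ allFin n → Adj G a b → NbrsIn G a b → NbrsIn G b a →
                   Isolated G r → Isolated G s → ∀ p → Wins G p
  evenCycle-edge {L = L} {r} {s} {a} {b} cyc part ab onlyA onlyB isoR isoS = tempo Φ uqL len
      (λ { (_ , isoR ∷ _ , _) → isolated⇒noPM isoR })
      (λ φ i∈ j∈ → inside-L (inj₁ refl) i∈ j∈ φ)
      legal step (cyc , isoR ∷ isoS ∷ [] , ab , onlyA , onlyB)
    where
    Φ : Graph n → Set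
    Φ G = Cycle G L × All (Isolated G) (r ∷ s ∷ []) × Adj G a b × NbrsIn G a b × NbrsIn G b a
    uq = allUnique part
    uqAB = Unique-++ʳ (r ∷ s ∷ []) uq
    uqL = Unique-++ʳ (r ∷ s ∷ a ∷ b ∷ []) uq
    a≢b = ∈∷⇒≢ uqAB (here refl)
    len = cycle-length (r ∷ s ∷ a ∷ b ∷ []) ≤-refl part

    inside-L : ∀ {G e u v} → Joins e u v → u ∈ L → v ∈ L → Φ G → Φ (e ∷ G)
    inside-L j u∈ v∈ (cyc , isos , ab , onlyA , onlyB) =
      Cycle-mono there cyc , isolated-inside uq j (there (there u∈)) (there (there v∈)) isos , Adj-there ab ,
      NbrsIn-∷ j (∈∷⇒≢ uqAB (there u∈)) (∈∷⇒≢ uqAB (there v∈)) onlyA ,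
      NbrsIn-∷ j (∈∷⇒≢ (Unique-tail uqAB) u∈) (∈∷⇒≢ (Unique-tail uqAB) v∈) onlyB

    inside-ab : ∀ {G e} → Joins e a b → Φ G → Φ (e ∷ G)
    inside-ab j (cyc , isos , ab , onlyA , onlyB) =
      Cycle-mono there cyc , isolated-inside uq j (here refl) (there (here refl)) isos , Adj-there ab ,
      NbrsIn-new j a≢b onlyA , NbrsIn-new (Sum.swap j) (≢-sym a≢b) onlyB

    legal : ∀ {G} → Φ G → ∃ (Legal G)
    legal (_ , isoR ∷ isoS ∷ [] , _) = isolated-legal isoR isoS (∈∷⇒≢ uq (here refl))
        (≢-sym (∈∷⇒≢ uq (there (here refl)))) (≢-sym (∈∷⇒≢ (Unique-tail uq) (here refl)))

    exchange : ∀ {r s} → r ∷ s ∷ a ∷ b ∷ L ↭ allFin n → r ∷ s ∷ b ∷ a ∷ L ↭ allFin n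
    exchange {r} {s} part = ↭-trans (prep r (prep s (swap b a ↭-refl))) part

    step : ∀ {G e} → Φ G → Legal G e → Φ (e ∷ G) ⊎ Wins (e ∷ G) Max
    step φ@(cyc , isoR ∷ isoS ∷ [] , ab , onlyA , onlyB) (i<j , _ , noPM) with move {R = r ∷ s ∷ []} part i<j
    ... | inside j u≢v (here refl) (here refl) = ⊥-elim (u≢v refl)
    -- `Legal` compares stored pairs, while `Adj` ignores their order, so this case is not
    -- dismissed; `Φ` survives it.
    ... | inside j u≢v (here refl) (there (here refl)) = inj₁ (inside-ab j φ)
    ... | inside j u≢v (here refl) (there (there v∈)) = inj₂ (insertEdge ab onlyB cyc part isoR isoS j v∈)
    ... | inside j u≢v (there (here refl)) (here refl) = inj₁ (inside-ab (Sum.swap j) φ)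
    ... | inside j u≢v (there (here refl)) (there (here refl)) = ⊥-elim (u≢v refl)
    ... | inside j u≢v (there (here refl)) (there (there v∈)) =
      inj₂ (insertEdge (Adj-sym ab) onlyA cyc (exchange part) isoR isoS j v∈)
    ... | inside j u≢v (there (there u∈)) (here refl) = inj₂ (insertEdge ab onlyB cyc part isoR isoS (Sum.swap j) u∈)
    ... | inside j u≢v (there (there u∈)) (there (here refl)) =
      inj₂ (insertEdge (Adj-sym ab) onlyA cyc (exchange part) isoR isoS (Sum.swap j) u∈)
    ... | inside j u≢v (there (there u∈)) (there (there v∈)) = inj₁ (inside-L j u∈ v∈ φ)
    ... | outer {R′ = []} j p = ⊥-elim (noPM (Matched⇒HasPM
            (pair (Adj-here j) (pair (Adj-there ab) (evenPath⇒Matched (Cycle⇒Path (Cycle-mono there cyc))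
              (even-pred (even-pred (even-length part)))))) (part-R p part)))
    ... | outer {R′ = _ ∷ _} j p = case ↭-length p of λ ()
    ... | cross {R′ = R′} j p h∈ with listOf1 R′ (↭-length-∷ refl p)
    ...   | t , refl with All-resp-↭ p (isoR ∷ isoS ∷ []) | h∈
    ...     | isoR′ ∷ isoT ∷ [] | here refl = inj₂ (completeStar ab onlyB cyc (part-R p part) isoR′ isoT j)
    ...     | isoR′ ∷ isoT ∷ [] | there (here refl) =
      inj₂ (completeStar (Adj-sym ab) onlyA cyc (exchange (part-R p part)) isoR′ isoT j)
    ...     | isoR′ ∷ isoT ∷ [] | there (there h∈L) = inj₂ (absorbIsolated ab onlyB cyc (part-R p part) isoR′ isoT j h∈L)

  twoIsolated : ∀ {m} → R ++ L ↭ allFin n → length R ≡ 2 + m → All (Isolated G) R → h ∈ L → ∃ (Legal G)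
  twoIsolated {R = r ∷ s ∷ R} part _ (isoR ∷ isoS ∷ _) h∈ =
    isolated-legal isoR isoS (∈∷⇒≢ uq (here refl))
      (≢-sym (∈∷⇒≢ uq (there (∈-++⁺ʳ R h∈)))) (≢-sym (∈∷⇒≢ (Unique-tail uq) (∈-++⁺ʳ R h∈)))
    where uq = allUnique part

  newEdge : r ∷ s ∷ c ∷ d ∷ L ↭ allFin n → All (Isolated G) (r ∷ s ∷ c ∷ d ∷ []) → Joins e r s →
    c ∷ d ∷ r ∷ s ∷ L ↭ allFin n × NbrsIn (e ∷ G) r s × NbrsIn (e ∷ G) s r ×
    Isolated (e ∷ G) c × Isolated (e ∷ G) d
  newEdge {r} {s} {c} {d} {L} part (isoR ∷ isoS ∷ isos) j
    with isolated-outer {R = c ∷ d ∷ []} (allUnique part) j isos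
  ... | isoC ∷ isoD ∷ [] =
    ↭-trans (++⁺ʳ L (++-comm (c ∷ d ∷ []) (r ∷ s ∷ []))) part ,
    NbrsIn-new j r≢s (Isolated⇒NbrsIn isoR) , NbrsIn-new (Sum.swap j) (≢-sym r≢s) (Isolated⇒NbrsIn isoS) ,
    isoC , isoD
    where r≢s = ∈∷⇒≢ (allUnique part) (here refl)

  -- An edge into the cycle is absorbed, leaving an odd cycle and three isolated vertices; an edge
  -- outside leads to `evenCycle-edge` with Max to move; chords preserve `Φ`.
  evenCycle₄ : Cycle G L → R ++ L ↭ allFin n → length R ≡ 4 → All (Isolated G) R → ∀ p → Wins G p
  evenCycle₄ {L = L} {R} cyc part |R|≡4 isos = tempo Φ (Unique-++ʳ R uq) len
      (λ (_ , isos) → someIsolated⇒noPM |R|≡4 isos)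
      (λ (cyc , isos) i∈ j∈ → Cycle-mono there cyc , isolated-inside uq (inj₁ refl) i∈ j∈ isos)
      legal step (cyc , isos)
    where
    Φ : Graph n → Set
    Φ G = Cycle G L × All (Isolated G) R
    uq = allUnique part
    len = cycle-length R (≤-reflexive |R|≡4) part

    legal : ∀ {G} → Φ G → ∃ (Legal G)
    legal (_ , isos) = let (h , h∈) = nonempty len in twoIsolated part |R|≡4 isos h∈

    step : ∀ {G e} → Φ G → Legal G e → Φ (e ∷ G) ⊎ Wins (e ∷ G) Max
    step (cyc , isos) (i<j , _ , _) with move {R = R} part i<j
    ... | inside j _ u∈ v∈ = inj₁ (Cycle-mono there cyc , isolated-inside uq j u∈ v∈ isos)
    ... | cross {R′ = R′} j p h∈ with listOf3 R′ (↭-length-∷ |R|≡4 p)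
    ...   | s , t , q , refl with All-resp-↭ p isos
    ...     | isoR ∷ isos′@(isoS ∷ _) =
      let part′ = part-R p part in
      inj₂ (absorb {R = t ∷ q ∷ []} cyc (2≤length len) part′ isoR isoS j h∈ λ j′ h′∈ part″ cyc′ _ →
        case isolated-cross (allUnique part′) j′ h′∈ (isolated-cross (allUnique part′) j h∈ isos′) of
          λ { (_ ∷ isoT ∷ isoQ ∷ []) → oddCycle₃-mini cyc′ part″ isoT isoQ })
    step (cyc , isos) (i<j , _ , _) | outer {r} {s} {R′} j p with listOf2 R′ (↭-length-∷∷ |R|≡4 p)
    ...   | t , q , refl =
      let (part′ , onlyR , onlyS , isoT , isoQ) = newEdge (part-R p part) (All-resp-↭ p isos) j
      in inj₂ (evenCycle-edge (Cycle-mono there cyc) part′ (Adj-here j) onlyR onlyS isoT isoQ Max)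

  -- Paths

  -- The vertex `r` need not be isolated: it may hang off the path by an edge that Mini has just
  -- played.
  closePath₃ : Linked (Adj G) L → r ∷ s ∷ c ∷ L ↭ allFin n → Isolated G s → Isolated G c → Wins G Max
  closePath₃ {L = L} {r} {s} {c} path part isoS isoC =
    closeCycle path (Unique-++ʳ (r ∷ s ∷ c ∷ []) uq) (2≤length len) isoC (apart R₃ uq c∈)
      (λ j u∈ v∈ cyc → oddCycle₃-mini cyc part
        (Isolated-∷ j (apart R₃ uq s∈ u∈) (apart R₃ uq s∈ v∈) isoS)
        (Isolated-∷ j (apart R₃ uq c∈ u∈) (apart R₃ uq c∈ v∈) isoC))
      (λ cyc → oddCycle₃-max cyc part isoC)
    where
    R₃ = r ∷ s ∷ c ∷ []
    uq = allUnique part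
    len = cycle-length R₃ (n≤1+n 3) part
    s∈ : s ∈ R₃
    s∈ = there (here refl)
    c∈ : c ∈ R₃
    c∈ = there (there (here refl))

  -- The path has an odd number of vertices, so after any move of Mini closing it gives an odd
  -- cycle. An edge among the three outside vertices makes that cycle good immediately.
  path₃-mini : Linked (Adj G) L → R ++ L ↭ allFin n → length R ≡ 3 → All (Isolated G) R → Wins G Mini
  path₃-mini {G = G} {L} {R} path part |R|≡3 isos =
    miniMove (let (h , h∈) = nonempty len in twoIsolated part |R|≡3 isos h∈) reply
    where
    len = cycle-length R (≤-trans (≤-reflexive |R|≡3) (n≤1+n 3)) part

    reply : ∀ e → Legal G e → Wins (e ∷ G) Max
    reply e (i<j , _ , _) with move {R = R} part i<j
    ... | inside j _ u∈ v∈ with listOf3 R |R|≡3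
    ...   | _ , _ , _ , refl with isolated-inside (allUnique part) j u∈ v∈ isos
    ...     | _ ∷ isoS ∷ isoT ∷ [] = closePath₃ (Path-mono there path) part isoS isoT
    reply e (i<j , _ , _) | cross {R′ = R′} j p h∈ with listOf2 R′ (↭-length-∷ |R|≡3 p)
    ...   | s , t , refl with All-resp-↭ p isos
    ...     | _ ∷ isos′ with isolated-cross (allUnique (part-R p part)) j h∈ isos′
    ...       | isoS ∷ isoT ∷ [] = closePath₃ (Path-mono there path) (part-R p part) isoS isoT
    reply e (i<j , _ , _) | outer {r} {s} {R′} j p with listOf1 R′ (↭-length-∷∷ |R|≡3 p)
    ...   | t , refl with All-resp-↭ p isos
    ...     | _ ∷ _ ∷ isos′ with isolated-outer {L = L} (allUnique (part-R p part)) j isos′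
    ...       | isoT ∷ [] =
      closeCycle (Path-mono there path) (Unique-++ʳ (r ∷ s ∷ t ∷ []) uq) (2≤length len) isoT t≢
        (λ j′ u∈ v∈ cyc → goodWins (good-oddCycle₃ cyc part′ (Adj-there (Adj-here j)))
          (isolated⇒noPM (Isolated-∷ j′ (t≢ u∈) (t≢ v∈) isoT)) Mini)
        (λ cyc → goodWins (good-oddCycle₃ cyc part′ (Adj-here j)) (isolated⇒noPM isoT) Max)
      where
      part′ = part-R p part
      uq = allUnique part′
      t≢ : ∀ {u} → u ∈ L → t ≢ u
      t≢ = apart (r ∷ s ∷ t ∷ []) uq (there (there (here refl)))

  closePath₄ : Linked (Adj G) L → R ++ L ↭ allFin n → length R ≡ 4 → All (Isolated G) R → Wins G Max
  closePath₄ {R = R@(_ ∷ _)} path part |R|≡4 isos@(iso ∷ _) =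
    closeCycle path (Unique-++ʳ R uq) (2≤length (cycle-length R (≤-reflexive |R|≡4) part)) iso
      (apart R uq (here refl))
      (λ j u∈ v∈ cyc → evenCycle₄ cyc part |R|≡4 (isolated-inside uq j u∈ v∈ isos) Mini)
      (λ cyc → evenCycle₄ cyc part |R|≡4 isos Max)
    where uq = allUnique part

  closePath-edge : Linked (Adj G) L → c ∷ d ∷ a ∷ b ∷ L ↭ allFin n → Adj G a b → NbrsIn G a b → NbrsIn G b a →
                   Isolated G c → Isolated G d → Wins G Max
  closePath-edge {L = L} {c} {d} {a} {b} path part ab onlyA onlyB isoC isoD =
    closeCycle path (Unique-++ʳ R₄ uq) (2≤length (cycle-length R₄ ≤-refl part)) isoC (≢L c∈)
      (λ j u∈ v∈ cyc → evenCycle-edge cyc part (Adj-there ab)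
        (NbrsIn-∷ j (≢L a∈ u∈) (≢L a∈ v∈) onlyA) (NbrsIn-∷ j (≢L b∈ u∈) (≢L b∈ v∈) onlyB)
        (Isolated-∷ j (≢L c∈ u∈) (≢L c∈ v∈) isoC) (Isolated-∷ j (≢L d∈ u∈) (≢L d∈ v∈) isoD) Mini)
      (λ cyc → evenCycle-edge cyc part ab onlyA onlyB isoC isoD Max)
    where
    R₄ = c ∷ d ∷ a ∷ b ∷ []
    uq = allUnique part
    c∈ : c ∈ R₄
    c∈ = here refl
    d∈ : d ∈ R₄
    d∈ = there (here refl)
    a∈ : a ∈ R₄
    a∈ = there (there (here refl))
    b∈ : b ∈ R₄
    b∈ = there (there (there (here refl)))
    ≢L : ∀ {r u} → r ∈ R₄ → u ∈ L → r ≢ u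
    ≢L = apart R₄ uq

  -- If Mini joins r to the first vertex x, the path has grown already; otherwise Max joins r to x as well.
  pathCross : ∀ {m} → Linked (Adj G) (x ∷ xs) → r ∷ R ++ x ∷ xs ↭ allFin n → length R ≡ suc m →
    All (Isolated G) (r ∷ R) → Joins e r h → h ∈ x ∷ xs →
    (Linked (Adj (e ∷ G)) (r ∷ x ∷ xs) → R ++ r ∷ x ∷ xs ↭ allFin n → All (Isolated (e ∷ G)) R →
      Wins (e ∷ G) Max) →
    (∀ {e′ L′} → x ∈ L′ → Linked (Adj (e′ ∷ e ∷ G)) L′ → R ++ L′ ↭ allFin n →
      All (Isolated (e′ ∷ e ∷ G)) R → Wins (e′ ∷ e ∷ G) Mini) →
    Wins (e ∷ G) Max
  pathCross {R = R} path part _ (_ ∷ isos) j (here refl) grown _ =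
    grown (Adj-here j ∷ Path-mono there path) (part-move R ↭-refl part)
      (isolated-cross (allUnique part) j (here refl) isos)
  pathCross {R = R@(_ ∷ _)} path part _ (isoR ∷ isos) j (there h∈) _ play =
    reroute (Path-mono there path) h∈ uqL (Adj-here j)
      (NbrsIn-new j (∈∷⇒≢ uqL (there h∈)) (Isolated⇒NbrsIn isoR))
      λ j′ p path′ →
        let isos′ = isolated-cross uq j′ (here refl) (isolated-cross uq j (there h∈) isos)
        in isolated⇒noPM (All.head isos′) ,
           play (∈-resp-↭ (↭-sym p) (there (here refl))) path′ (part-move R p part) isos′
    where
    uq = allUnique part
    uqL = Unique-∷-++ʳ R uq

  -- The membership `x ∈ L` records that the path is nonempty, so that it has a first vertex to
  -- extend at.
  PathWins : ℕ → Player → Set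
  PathWins k p = ∀ {G x L R} → x ∈ L → Linked (Adj G) L → R ++ L ↭ allFin n → length R ≡ k →
                 All (Isolated G) R → Wins G p

  -- Max prepends an isolated vertex. At least one more remains, so no perfect matching arises.
  path-max : ∀ {k} → PathWins (suc k) Mini → PathWins (2 + k) Max
  path-max mini {L = x ∷ xs} {R = r ∷ R@(_ ∷ _)} _ path part |R| (isoR ∷ isos) =
    maxPlays (apart (r ∷ R) uq (here refl) (here refl)) (isoR x) λ j →
      let isos′ = isolated-cross uq j (here refl) isos
      in isolated⇒noPM (All.head isos′) ,
         mini (here refl) (Adj-here j ∷ Path-mono there path) (part-move R ↭-refl part) (suc-injective |R|) isos′
    where uq = allUnique part

  -- A second base case, since a round that uses two isolated vertices would leave only two. Max
  -- turns to the cycle here, except that a crossing edge of Mini may first require rerouting, which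
  -- leaves three.
  path₄-mini : PathWins 4 Mini
  path₄-mini {G = G} {L = x ∷ xs} {R = R} _ path part |R| isos =
    miniMove (twoIsolated part |R| isos (here refl)) reply
    where
    reply : ∀ e → Legal G e → Wins (e ∷ G) Max
    reply e (i<j , _ , _) with move {R = R} part i<j
    ... | inside j _ u∈ v∈ = closePath₄ (Path-mono there path) part |R| (isolated-inside (allUnique part) j u∈ v∈ isos)
    ... | cross {R′ = R′} j p h∈ = pathCross path (part-R p part) |R′| (All-resp-↭ p isos) j h∈
            grown (λ x∈ path′ part′ isos′ → path₃-mini path′ part′ |R′| isos′)
      where
      |R′| = ↭-length-∷ |R| p
      grown : Linked (Adj (e ∷ G)) _ → R′ ++ _ ↭ allFin n → All (Isolated (e ∷ G)) R′ → Wins (e ∷ G) Max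
      grown path′ part′ isos′ with listOf3 R′ |R′| | isos′
      ... | _ , _ , _ , refl | _ ∷ isoS ∷ isoT ∷ [] = closePath₃ path′ part′ isoS isoT
    reply e (i<j , _ , _) | outer {R′ = R′} j p with listOf2 R′ (↭-length-∷∷ |R| p)
    ... | c , d , refl =
      let (part′ , onlyR , onlyS , isoC , isoD) = newEdge (part-R p part) (All-resp-↭ p isos) j
      in closePath-edge (Path-mono there path) part′ (Adj-here j) onlyR onlyS isoC isoD

  -- A round uses one or two isolated vertices, hence two induction hypotheses.
  path-step : ∀ {k} → PathWins (suc k) Mini → PathWins (2 + k) Mini → PathWins (3 + k) Mini
  path-step {k} mini₁ mini₂ {G = G} {L = x ∷ xs} {R = R} _ path part |R| isos =
    miniMove (twoIsolated part |R| isos (here refl)) reply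
    where
    reply : ∀ e → Legal G e → Wins (e ∷ G) Max
    reply e (i<j , _ , _) with move {R = R} part i<j
    ... | inside j _ u∈ v∈ = path-max mini₂ (here refl) (Path-mono there path) part |R|
            (isolated-inside (allUnique part) j u∈ v∈ isos)
    ... | cross {R′ = R′} j p h∈ = pathCross path (part-R p part) |R′| (All-resp-↭ p isos) j h∈
            (λ path′ part′ isos′ → path-max mini₁ (here refl) path′ part′ |R′| isos′)
            (λ x∈ path′ part′ isos′ → mini₂ x∈ path′ part′ |R′| isos′)
      where |R′| = ↭-length-∷ |R| p
    ... | outer {r} {s} {R′ = R′} j p = extend (All-resp-↭ p isos)
      where
      |R′| : length R′ ≡ suc k
      |R′| = ↭-length-∷∷ |R| p
      part′ = part-R p part
      uq = allUnique part′
      extend : All (Isolated G) (r ∷ s ∷ R′) → Wins (e ∷ G) Max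
      -- Mini's edge becomes the new beginning of the path: Max joins `r` to `x`, and the path
      -- starts `s`, `r`, `x`.
      extend (isoR ∷ _ ∷ isos′) = maxPlays (∈∷⇒≢ uq (there (∈-++⁺ʳ R′ (here refl))))
        (λ rx → apart (s ∷ R′) (Unique-tail uq) (here refl) (here refl)
          (sym (NbrsIn-new j (∈∷⇒≢ uq (here refl)) (Isolated⇒NbrsIn isoR) x rx)))
        λ j′ →
          let isos″ = isolated-cross {R = R′} (Unique-tail (Unique-resp-↭ (swap r s ↭-refl) uq)) j′ (here refl)
                        (isolated-outer uq j isos′)
          in someIsolated⇒noPM |R′| isos″ ,
             mini₁ (here refl)
               (Adj-there (Adj-sym (Adj-here j)) ∷ Adj-here j′ ∷ Path-mono (there ∘ there) path)
               (part-move R′ ↭-refl (part-move (s ∷ R′) ↭-refl part′)) |R′| isos″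

  path-mini : ∀ m → PathWins (3 + m) Mini
  path-mini zero _ = path₃-mini
  path-mini (suc zero) = path₄-mini
  path-mini (suc (suc m)) = path-step (path-mini m) (path-mini (suc m))

theorem1p6 : (n : ℕ) → 8 ≤ n → 2 ∣ n →
    ScoreAtLeast n Mini ((n ∸ 4) C 2) × ScoreAtLeast n Max ((n ∸ 4) C 2)
theorem1p6 n@(suc (suc (suc (suc (suc m))))) 8≤n@(s≤s (s≤s (s≤s (s≤s (s≤s _))))) 2∣n =
    -- Here n = 5 + m. The initial path is the single vertex `Fin.zero`, and the other 4 + m
    -- vertices are isolated.
    path-mini (suc m) (here refl) [-] part len isos , path-max (path-mini m) (here refl) [-] part len isos
  where
  open Strategy 8≤n 2∣n
  R₀ : List (Fin n)
  R₀ = tabulate Fin.suc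
  part : R₀ ++ Fin.zero ∷ [] ↭ allFin n
  part = ++-comm R₀ (Fin.zero ∷ [])
  len : length R₀ ≡ 4 + m
  len = length-tabulate Fin.suc
  isos : All (Isolated []) R₀
  isos = All.tabulate λ { _ _ (inj₁ ()) ; _ _ (inj₂ ()) }
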